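{- There exists a $0$-dimensional topological space of cardinality $2^{\omega}$ which has property $P_{<\omega}$.
   Context: For a natural number $n\ge 1$, a topological space $X$ has property $P_n$ if it is Hausdorff and, whenever $U_0,\dots,U_{n-1}$ are open subsets of $X$ with $\bigcap_{i<n}U_i=\emptyset$, we have $|U_i|\le\omega$ for some $i<n$. A space has property $P_{<\omega}$ if it has property $P_n$ for every $n<\omega$. A space is $0$-dimensional if it has a base of clopen sets. -}

module Defs where

open import Level using (0ℓ; suc)
open import Data.Bool.Base using (Bool)
open import Data.Fin.Base using (Fin)
open import Data.Nat.Base using (ℕ; _≤_)
open import Data.Product.Base using (∃-syntax; _×_; proj₁)
open import Function.Bundles using (Bijection; Injection)
open import Relation.Binary.Bundles using (Setoid)
import Relation.Binary.Construct.On as On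
open import Relation.Binary.PropositionalEquality using (_→-setoid_; setoid)
open import Relation.Nullary.Negation.Core using (¬_)
open import Relation.Unary
  using (Pred; _∈_; _⊆_; _≐_; _∩_; ∁; ⋃; ⋂; Empty; U)

-- Points form a setoid so that spaces whose points are functions can be
-- treated without function extensionality.  Subsets are predicates; open sets
-- are required to respect equality of points, and openness depends only on
-- the extension of a subset.
record TopologicalSpace : Set (suc 0ℓ) where
  field
    points : Setoid 0ℓ 0ℓ

  open Setoid points public using (_≈_) renaming (Carrier to Point)

  Subset : Set (suc 0ℓ)
  Subset = Pred Point 0ℓ

  field
    IsOpen     : Pred Subset 0ℓ
    open-≈     : ∀ {V} → IsOpen V → ∀ {x y} → x ≈ y → x ∈ V → y ∈ V
    open-≐     : ∀ {V W} → V ≐ W → IsOpen V → IsOpen W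
    open-whole : IsOpen U
    open-∩     : ∀ {V W} → IsOpen V → IsOpen W → IsOpen (V ∩ W)
    -- With I empty this makes the empty set open.
    open-⋃     : ∀ (I : Set) (V : I → Subset) →
                 (∀ i → IsOpen (V i)) → IsOpen (⋃ I V)

  IsClopen : Pred Subset 0ℓ
  IsClopen V = IsOpen V × IsOpen (∁ V)

  IsBase : Pred Subset 0ℓ → Set (suc 0ℓ)
  IsBase 𝓑 =
      (∀ {B} → B ∈ 𝓑 → IsOpen B)
    × (∀ {V} → IsOpen V → ∀ {x} → x ∈ V →
         ∃[ B ] (B ∈ 𝓑 × x ∈ B × B ⊆ V))

  ZeroDimensional : Set (suc 0ℓ)
  ZeroDimensional = ∃[ 𝓑 ] (IsBase 𝓑 × (∀ {B} → B ∈ 𝓑 → IsClopen B))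

  Hausdorff : Set (suc 0ℓ)
  Hausdorff = ∀ {x y} → ¬ (x ≈ y) →
    ∃[ V ] ∃[ W ] (IsOpen V × IsOpen W × x ∈ V × y ∈ W × Empty (V ∩ W))

  -- |V| ≤ ω.  Elements of V are compared as points, ignoring the membership
  -- proofs.
  AtMostCountable : Pred Subset 0ℓ
  AtMostCountable V =
    Injection (On.setoid points (proj₁ {B = V})) (setoid ℕ)

  -- Meant for n ≥ 1.
  PropertyP : ℕ → Set (suc 0ℓ)
  PropertyP n =
      Hausdorff
    × (∀ (V : Fin n → Subset) → (∀ i → IsOpen (V i)) →
         Empty (⋂ (Fin n) V) → ∃[ i ] AtMostCountable (V i))

  PropertyP<ω : Set (suc 0ℓ)
  PropertyP<ω = ∀ n → 1 ≤ n → PropertyP n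

  -- Sequences of Booleans are compared pointwise.
  HasCardinality2^ω : Set
  HasCardinality2^ω = Bijection points (ℕ →-setoid Bool)

{-# OPTIONS --safe #-}

-- Let D be a countable set whose elements n code finite lists of binary
-- strings, and give a point x of the Cantor set the neighbourhoods
--   {x} ∪ {n ∈ D : n lists an initial segment of x of length ≥ k, but none of
--                  any s ∈ S},      k ∈ ℕ, S finite, x ∉ S,
-- the points of D being isolated.  Putting y into S separates x from y, so
-- these sets are clopen.  Each uncountable open set V i contains uncountably
-- many x outside D, each with its finite set S(x).  A free-set argument gives
-- x i ∈ V i with x j ∉ S(x i) for all i and j, and then an n listing long
-- enough initial segments of all the x i belongs to every V i.  To have the
-- Cantor set itself as the set of points, D is realised inside it as the set
-- of indicator functions of singletons.
module Submission where

open import Defs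
open import Level using (0ℓ)
open import Axiom.ExcludedMiddle using (ExcludedMiddle)
open import Data.Bool.Base using (Bool; true; false; T)
open import Data.Empty using (⊥-elim)
open import Data.Fin.Base using (Fin; zero; suc)
open import Data.List.Base
  using (List; []; _∷_; _++_; applyUpTo; concat; length; tabulate)
open import Data.List.Membership.Propositional using (_∈_; _∉_)
open import Data.List.Membership.Propositional.Properties
  using (∈-tabulate⁺; ∈-tabulate⁻)
open import Data.List.Properties using (∷-injective; length-applyUpTo)
open import Data.List.Relation.Unary.All as All using (All; []; _∷_)
open import Data.List.Relation.Unary.All.Properties
  using (++⁺; ++⁻ˡ; ++⁻ʳ; concat⁻; tabulate⁺; tabulate⁻)
open import Data.Nat.Base
open import Data.Nat.Binary.Base using (ℕᵇ; 2[1+_]; 1+[2_]; fromℕ; toℕ)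
  renaming (zero to 0ᵇ)
open import Data.Nat.Binary.Properties using (fromℕ-toℕ)
open import Data.Nat.Properties
open import Data.Product.Base
  using (Σ-syntax; ∃; ∃-syntax; _×_; _,_; proj₁; proj₂)
open import Data.Sum.Base using (_⊎_; inj₁; inj₂)
open import Data.Unit.Base using (tt)
open import Function.Base using (_∘_)
open import Function.Construct.Identity using (bijection)
open import Relation.Binary.PropositionalEquality
open import Relation.Nullary using (¬_; yes; no; contradiction)
open import Relation.Nullary.Decidable using (decidable-stable)
open import Relation.Unary using (Pred; ∁; ⋂; Empty)

-- Sequences up to pointwise equality

Cantor : Set
Cantor = ℕ → Bool

infix 4 _avoids_
_avoids_ : Cantor → List Cantor → Set
x avoids S = All (λ s → ¬ (x ≗ s)) S

avoids-≗ : ∀ {x y S} → x ≗ y → x avoids S → y avoids S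
avoids-≗ x≗y = All.map (λ x≉s y≗s → x≉s (λ i → trans (x≗y i) (y≗s i)))

≗-sym : ∀ {x y : Cantor} → x ≗ y → y ≗ x
≗-sym x≗y = sym ∘ x≗y

≗-trans : ∀ {x y z : Cantor} → x ≗ y → y ≗ z → x ≗ z
≗-trans x≗y y≗z i = trans (x≗y i) (y≗z i)

-- Properties of all large numbers

Eventually : Pred ℕ 0ℓ → Set
Eventually P = ∃[ k ] (∀ m → k ≤ m → P m)

eventually-× : ∀ {P Q : Pred ℕ 0ℓ} →
  Eventually P → Eventually Q → Eventually (λ m → P m × Q m)
eventually-× (k , p) (l , q) = k ⊔ l , λ m k⊔l≤m →
  p m (m⊔n≤o⇒m≤o k l k⊔l≤m) , q m (m⊔n≤o⇒n≤o k l k⊔l≤m)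

eventually-All : ∀ {A : Set} {R : A → Pred ℕ 0ℓ} {xs : List A} →
  All (λ x → Eventually (R x)) xs → Eventually (λ m → All (λ x → R x m) xs)
eventually-All []         = 0 , λ _ _ → []
eventually-All (ev ∷ evs) with eventually-× ev (eventually-All evs)
... | k , h = k , λ m k≤m → proj₁ (h m k≤m) ∷ proj₂ (h m k≤m)

eventually-Fin : ∀ {n} {R : Fin n → Pred ℕ 0ℓ} →
  (∀ i → Eventually (R i)) → Eventually (λ m → ∀ i → R i m)
eventually-Fin {R = R} ev with eventually-All {R = R} (tabulate⁺ {f = λ i → i} ev)
... | k , h = k , λ m k≤m → tabulate⁻ (h m k≤m)

-- Coding finite lists of binary strings

prepend : Bool → List (List Bool) → List (List Bool)
prepend b []       = []
prepend b (s ∷ ss) = (b ∷ s) ∷ ss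

-- The digits of bijective binary form a prefix code: `2[1+_]` alone starts a new empty string, and
-- `1+[2_]` followed by either digit prepends a bit to the first string. `1+[2 0ᵇ ]` and prepending
-- to an empty list never arise from `encodeᵇ`, so their values are arbitrary.
decodeᵇ : ℕᵇ → List (List Bool)
decodeᵇ 0ᵇ                = []
decodeᵇ 2[1+ r ]          = [] ∷ decodeᵇ r
decodeᵇ 1+[2 0ᵇ ]         = []
decodeᵇ 1+[2 2[1+ r ] ]   = prepend true (decodeᵇ r)
decodeᵇ 1+[2 1+[2 r ] ]   = prepend false (decodeᵇ r)

pushᵇ : List Bool → ℕᵇ → ℕᵇ
pushᵇ []          r = 2[1+ r ]
pushᵇ (true ∷ s)  r = 1+[2 2[1+ pushᵇ s r ] ]
pushᵇ (false ∷ s) r = 1+[2 1+[2 pushᵇ s r ] ]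

encodeᵇ : List (List Bool) → ℕᵇ
encodeᵇ []       = 0ᵇ
encodeᵇ (s ∷ ss) = pushᵇ s (encodeᵇ ss)

decodeᵇ-pushᵇ : ∀ s r → decodeᵇ (pushᵇ s r) ≡ s ∷ decodeᵇ r
decodeᵇ-pushᵇ []          r = refl
decodeᵇ-pushᵇ (true ∷ s)  r = cong (prepend true) (decodeᵇ-pushᵇ s r)
decodeᵇ-pushᵇ (false ∷ s) r = cong (prepend false) (decodeᵇ-pushᵇ s r)

decodeᵇ-encodeᵇ : ∀ ss → decodeᵇ (encodeᵇ ss) ≡ ss
decodeᵇ-encodeᵇ []       = refl
decodeᵇ-encodeᵇ (s ∷ ss) =
  trans (decodeᵇ-pushᵇ s (encodeᵇ ss)) (cong (s ∷_) (decodeᵇ-encodeᵇ ss))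

decode : ℕ → List (List Bool)
decode n = decodeᵇ (fromℕ n)

encode : List (List Bool) → ℕ
encode ss = toℕ (encodeᵇ ss)

decode-encode : ∀ ss → decode (encode ss) ≡ ss
decode-encode ss =
  trans (cong decodeᵇ (fromℕ-toℕ (encodeᵇ ss))) (decodeᵇ-encodeᵇ ss)

-- Initial segments

applyUpTo-cong : ∀ {x y : Cantor} → x ≗ y → ∀ m → applyUpTo x m ≡ applyUpTo y m
applyUpTo-cong x≗y zero    = refl
applyUpTo-cong x≗y (suc m) =
  cong₂ _∷_ (x≗y 0) (applyUpTo-cong (x≗y ∘ suc) m)

applyUpTo-≡⇒≡ : ∀ (x y : Cantor) {i m} → i < m →
  applyUpTo x m ≡ applyUpTo y m → x i ≡ y i
applyUpTo-≡⇒≡ x y {zero}  z<s       eq = proj₁ (∷-injective eq)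
applyUpTo-≡⇒≡ x y {suc i} (s<s i<m) eq =
  applyUpTo-≡⇒≡ (x ∘ suc) (y ∘ suc) i<m (proj₂ (∷-injective eq))

applyUpTo-length : ∀ (x y : Cantor) {m n} →
  applyUpTo x m ≡ applyUpTo y n → m ≡ n
applyUpTo-length x y {m} {n} eq =
  trans (sym (length-applyUpTo x m)) (trans (cong length eq) (length-applyUpTo y n))

eventually-unlisted : ∀ (ss : List (List Bool)) →
  Eventually (λ m → ∀ (x : Cantor) → applyUpTo x m ∉ ss)
eventually-unlisted ss with eventually-All {R = λ s m → length s ≢ m} {ss}
  (All.universal (λ s → suc (length s) , λ m ∣s∣<m → <⇒≢ ∣s∣<m) ss)
... | k , h = k , λ m k≤m x x↾m∈ss →
  All.lookup (h m k≤m) x↾m∈ss (length-applyUpTo x m)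

-- Basic neighbourhoods

Lists : ℕ → Cantor → ℕ → Set
Lists n x k = ∃[ m ] (k ≤ m × applyUpTo x m ∈ decode n)

Omits : ℕ → Cantor → Set
Omits n s = ∀ m → applyUpTo s m ∉ decode n

Near : Cantor → List Cantor → ℕ → ℕ → Set
Near x S k n = Lists n x k × All (Omits n) S

Lists-≗ : ∀ {n x y k} → x ≗ y → Lists n x k → Lists n y k
Lists-≗ {n} x≗y (m , k≤m , x↾m∈) =
  m , k≤m , subst (_∈ decode n) (applyUpTo-cong x≗y m) x↾m∈

Near-≗ : ∀ {x y S k n} → x ≗ y → Near x S k n → Near y S k n
Near-≗ {n = n} x≗y (listed , omitted) = Lists-≗ {n} x≗y listed , omitted

code : ℕ → Cantor
code n i = i ≡ᵇ n

code-injective : ∀ {m n} → code m ≗ code n → m ≡ n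
code-injective {m} {n} eq = ≡ᵇ⇒≡ m n (subst T (eq m) (≡⇒≡ᵇ m m refl))

IsCode : Pred Cantor 0ℓ
IsCode x = ∃[ n ] x ≗ code n

IsCode-≗ : ∀ {x y} → x ≗ y → IsCode x → IsCode y
IsCode-≗ x≗y (n , x≗n) = n , ≗-trans (≗-sym x≗y) x≗n

Ball : Cantor → List Cantor → ℕ → Pred Cantor 0ℓ
Ball x S k z = z ≗ x ⊎ (∃[ n ] (z ≗ code n × Near x S k n))

-- Codes are isolated, so `inner` constrains only the other points; there the centre of the ball is
-- in `V` already, and only its codes remain to be checked.
record Open (V : Pred Cantor 0ℓ) : Set where
  field
    respects : ∀ {x y} → x ≗ y → V x → V y
    inner    : ∀ {x} → V x → ¬ IsCode x →
      ∃[ S ] ∃[ k ] (x avoids S × (∀ n → Near x S k n → V (code n)))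

open Open using (respects; inner)

-- The space and its clopen balls

space : TopologicalSpace
space = record
  { points     = ℕ →-setoid Bool
  ; IsOpen     = Open
  ; open-≈     = λ oV → respects oV
  ; open-≐     = λ (V⊆W , W⊆V) oV → record
      { respects = λ x≗y → V⊆W ∘ respects oV x≗y ∘ W⊆V
      ; inner    = λ x∈W x∉D → let S , k , av , h = inner oV (W⊆V x∈W) x∉D in
          S , k , av , λ n → V⊆W ∘ h n
      }
  ; open-whole = record
      { respects = λ _ _ → tt
      ; inner    = λ _ _ → [] , 0 , [] , λ _ _ → tt
      }
  ; open-∩     = λ oV oW → record
      { respects = λ x≗y (x∈V , x∈W) → respects oV x≗y x∈V , respects oW x≗y x∈W
      ; inner    = λ (x∈V , x∈W) x∉D →
          let S , k , av , h = inner oV x∈V x∉D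
              R , l , aw , g = inner oW x∈W x∉D in
          S ++ R , k ⊔ l , ++⁺ av aw , λ n ((m , k⊔l≤m , x↾m∈) , om) →
            h n ((m , m⊔n≤o⇒m≤o k l k⊔l≤m , x↾m∈) , ++⁻ˡ S om) ,
            g n ((m , m⊔n≤o⇒n≤o k l k⊔l≤m , x↾m∈) , ++⁻ʳ S om)
      }
  ; open-⋃     = λ I V oV → record
      { respects = λ x≗y (i , x∈Vi) → i , respects (oV i) x≗y x∈Vi
      ; inner    = λ (i , x∈Vi) x∉D → let S , k , av , h = inner (oV i) x∈Vi x∉D in
          S , k , av , λ n → (i ,_) ∘ h n
      }
  }

open TopologicalSpace space
  using (IsClopen; ZeroDimensional; Hausdorff; AtMostCountable; PropertyP)

Ball-open : ∀ {x S k} → ¬ IsCode x → x avoids S → Open (Ball x S k)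
Ball-open {x} {S} {k} x∉D av = record
  { respects = λ where
      y≗z (inj₁ y≗x)            → inj₁ (≗-trans (≗-sym y≗z) y≗x)
      y≗z (inj₂ (n , y≗n , nr)) → inj₂ (n , ≗-trans (≗-sym y≗z) y≗n , nr)
  ; inner    = λ where
      (inj₁ z≗x) z∉D → S , k , avoids-≗ (≗-sym z≗x) av ,
        λ n nr → inj₂ (n , (λ _ → refl) , Near-≗ {n = n} z≗x nr)
      (inj₂ (n , z≗n , _)) z∉D → contradiction (n , z≗n) z∉D
  }

∁Ball-open : ∀ {x S k} → ¬ IsCode x → Open (∁ (Ball x S k))
∁Ball-open {x} {S} {k} x∉D = record
  { respects = λ where
      y≗z y∉B (inj₁ z≗x)            → y∉B (inj₁ (≗-trans y≗z z≗x))
      y≗z y∉B (inj₂ (n , z≗n , nr)) → y∉B (inj₂ (n , ≗-trans y≗z z≗n , nr))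
  -- Every code in the ball lists an initial segment of `x`, so forbidding `x` alone keeps all of
  -- them away from `z`.
  ; inner    = λ z∉B z∉D → x ∷ [] , 0 , (z∉B ∘ inj₁) ∷ [] , λ where
      n (_ , omits ∷ []) (inj₁ n≗x) → x∉D (n , ≗-sym n≗x)
      n (_ , omits ∷ []) (inj₂ (n′ , n≗n′ , (m , _ , x↾m∈) , _)) →
        omits m (subst (λ j → applyUpTo x m ∈ decode j)
                       (sym (code-injective n≗n′)) x↾m∈)
  }

singleton-open : ∀ {x} → IsCode x → Open (_≗ x)
singleton-open x∈D = record
  { respects = λ y≗z y≗x → ≗-trans (≗-sym y≗z) y≗x
  ; inner    = λ z≗x z∉D → contradiction (IsCode-≗ (≗-sym z≗x) x∈D) z∉D
  }

module Classical (em : ExcludedMiddle 0ℓ) where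

  -- Zero-dimensionality and separation

  ∁singleton-open : ∀ x → Open (∁ (_≗ x))
  ∁singleton-open x = record
    { respects = λ y≗z y≉x z≗x → y≉x (≗-trans y≗z z≗x)
    ; inner    = λ _ _ → inner′ (em {IsCode x})
    }
    where
    inner′ : ∀ {z} → _ → ∃[ S ] ∃[ k ]
      (z avoids S × (∀ n → Near z S k n → ¬ (code n ≗ x)))
    -- The code `n` lists finitely many strings; asking for a longer segment of `z` excludes it.
    inner′ {z} (yes (n , x≗n)) with eventually-unlisted (decode n)
    ... | k , h = [] , k , [] , λ n′ ((m , k≤m , z↾m∈) , _) n′≗x →
      h m k≤m z (subst (λ j → applyUpTo z m ∈ decode j)
                       (code-injective (≗-trans n′≗x x≗n)) z↾m∈)
    inner′ (no x∉D) = [] , 0 , [] , λ n _ n≗x → x∉D (n , ≗-sym n≗x)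

  zeroDimensional : ZeroDimensional
  -- The base consists of all clopen sets.
  zeroDimensional = IsClopen , (proj₁ , base) , λ clopen → clopen
    where
    base : ∀ {V} → Open V → ∀ {x} → V x →
      ∃[ B ] (IsClopen B × B x × (∀ {z} → B z → V z))
    base {V} oV {x} x∈V with em {IsCode x}
    ... | yes x∈D = (_≗ x) , (singleton-open x∈D , ∁singleton-open x) ,
      (λ _ → refl) , λ z≗x → respects oV (≗-sym z≗x) x∈V
    ... | no x∉D with inner oV x∈V x∉D
    ...   | S , k , av , h = Ball x S k , (Ball-open x∉D av , ∁Ball-open x∉D) ,
      inj₁ (λ _ → refl) , λ where
        (inj₁ z≗x)            → respects oV (≗-sym z≗x) x∈V
        (inj₂ (n , z≗n , nr)) → respects oV (≗-sym z≗n) (h n nr)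

  hausdorff : Hausdorff
  hausdorff {x} {y} x≉y with zeroDimensional
  ... | _ , (_ , base) , clopen with base (∁singleton-open y) x≉y
  ...   | B , B∈𝓑 , x∈B , B⊆∁y =
    B , ∁ B , proj₁ (clopen B∈𝓑) , proj₂ (clopen B∈𝓑) , x∈B ,
    (λ y∈B → B⊆∁y y∈B (λ _ → refl)) , λ z (z∈B , z∉B) → z∉B z∈B

  -- Countable and uncountable sets

  least : (P : Pred ℕ 0ℓ) → ∃ P → ∃[ n ] (P n × (∀ {m} → P m → n ≤ m))
  least P (n , p) = search P n p
    where
    search : (P : Pred ℕ 0ℓ) → ∀ n → P n → ∃[ n ] (P n × (∀ {m} → P m → n ≤ m))
    search P zero    p = 0 , p , λ _ → z≤n
    search P (suc n) p with em {P 0}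
    ... | yes p₀ = 0 , p₀ , λ _ → z≤n
    ... | no ¬p₀ with search (P ∘ suc) n p
    ...   | l , q , min = suc l , q , λ {m} → bound m
      where
      bound : ∀ m → P m → suc l ≤ m
      bound zero    p₀ = contradiction p₀ ¬p₀
      bound (suc m) p′ = s≤s (min p′)

  -- An arbitrary index might vary with the representative or the membership proof. The least one
  -- depends only on the point up to `_≗_`, which gives `cong`.
  enumerated⇒countable : ∀ {V} (e : ℕ → Cantor) →
    (∀ {x} → V x → ∃[ n ] x ≗ e n) → AtMostCountable V
  enumerated⇒countable {V} e enum = record
    { to        = proj₁ ∘ index
    ; cong      = λ {v} {w} v≗w → ≤-antisym
        (proj₂ (proj₂ (index v)) (≗-trans v≗w (proj₁ (proj₂ (index w)))))
        (proj₂ (proj₂ (index w)) (≗-trans (≗-sym v≗w) (proj₁ (proj₂ (index v)))))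
    ; injective = λ {v} {w} eq → ≗-trans (proj₁ (proj₂ (index v)))
        (≗-sym (subst (λ n → proj₁ w ≗ e n) (sym eq) (proj₁ (proj₂ (index w)))))
    }
    where
    index : (v : ∃ V) →
      ∃[ n ] (proj₁ v ≗ e n × (∀ {m} → proj₁ v ≗ e m → n ≤ m))
    index (x , x∈V) = least (λ n → x ≗ e n) (enum x∈V)

  -- Each exhausted list costs one step, filled with code 0; this keeps the
  -- recursion structural in the index.
  flatten : List Cantor → (ℕ → List Cantor) → ℕ → Cantor
  flatten (x ∷ xs) e zero    = x
  flatten (x ∷ xs) e (suc k) = flatten xs e k
  flatten []       e zero    = code 0
  flatten []       e (suc k) = flatten (e 0) (e ∘ suc) k

  flatten-head : ∀ {x} xs e → ¬ (x avoids xs) → ∃[ k ] x ≗ flatten xs e k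
  flatten-head []       e ¬av = contradiction [] ¬av
  flatten-head {x} (y ∷ xs) e ¬av with em {x ≗ y}
  ... | yes x≗y = 0 , x≗y
  ... | no x≉y with flatten-head xs e (¬av ∘ (x≉y ∷_))
  ...   | k , eq = suc k , eq

  flatten-skip : ∀ {x} xs e → ∃[ k ] x ≗ flatten [] e k → ∃[ k ] x ≗ flatten xs e k
  flatten-skip []       e w = w
  flatten-skip (y ∷ xs) e w with flatten-skip xs e w
  ... | k , eq = suc k , eq

  flatten-complete : ∀ {x} e m → ¬ (x avoids e m) → ∃[ k ] x ≗ flatten [] e k
  flatten-complete e zero    ¬av with flatten-head (e 0) (e ∘ suc) ¬av
  ... | k , eq = suc k , eq
  flatten-complete e (suc m) ¬av
    with flatten-skip (e 0) (e ∘ suc) (flatten-complete (e ∘ suc) m ¬av)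
  ... | k , eq = suc k , eq

  -- A positive form of uncountability, with finite lists as terms so that one point can be chosen
  -- to escape countably many finite sets at once.
  Uncountable : Pred Cantor 0ℓ → Set
  Uncountable A = ∀ (e : ℕ → List Cantor) → ∃[ x ] (A x × (∀ m → x avoids e m))

  uncountable-noncodes : ∀ {V} → ¬ AtMostCountable V →
    Uncountable (λ x → V x × ¬ IsCode x)
  uncountable-noncodes {V} ¬cV e
    with em {∃[ x ] ((V x × ¬ IsCode x) × (∀ m → x avoids e m))}
  ... | yes found = found
  ... | no none = contradiction (enumerated⇒countable (flatten [] e⁺) enum) ¬cV
    where
    e⁺ : ℕ → List Cantor
    -- Interleaving the codes makes an escaping point a non-code as well.
    e⁺ m = code m ∷ e m
    enum : ∀ {x} → V x → ∃[ k ] x ≗ flatten [] e⁺ k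
    enum {x} x∈V with em {∃[ k ] x ≗ flatten [] e⁺ k}
    ... | yes hit = hit
    ... | no miss = contradiction
      (x , (x∈V , λ (n , x≗n) → All.head (av n) x≗n) , All.tail ∘ av) none
      where
      av : ∀ m → x avoids e⁺ m
      av m = decidable-stable em (miss ∘ flatten-complete e⁺ m)

  -- Free tuples

  record FreeTuple {n} (A : Fin n → Pred Cantor 0ℓ)
      (f : ∀ i {x} → A i x → List Cantor) (E : List Cantor) : Set where
    field
      pt     : Fin n → Cantor
      member : ∀ i → A i (pt i)
      fresh  : ∀ i → pt i avoids E
      free   : ∀ i j → pt j avoids f i (member i)

  open FreeTuple using (pt; member; fresh; free)

  -- The induction hypothesis yields a sequence of pairwise disjoint free
  -- tuples for the remaining sets.  A point x of the first set can avoid all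
  -- the (countably many) points forbidden by these tuples, and the finite set
  -- forbidden by x meets only finitely many of the tuples.
  freeTuple : ∀ {n} (A : Fin n → Pred Cantor 0ℓ)
    (f : ∀ i {x} → A i x → List Cantor) →
    (∀ i → Uncountable (A i)) →
    (∀ i {x} (x∈A : A i x) → x avoids f i x∈A) →
    ∀ E → FreeTuple A f E
  freeTuple {zero}  A f unc self E = record
    { pt = λ () ; member = λ () ; fresh = λ () ; free = λ () }
  freeTuple {suc n} A f unc self E = record
    { pt     = λ where zero → x ; (suc i) → pt t i
    ; member = λ where zero → x∈A ; (suc i) → member t i
    ; fresh  = λ where
        -- Any index would serve, since every `forbidden j` begins with `E`.
        zero    → ++⁻ˡ E (x-avoids 0)
        (suc i) → used-⊇ {j = 0} {k = j₀} z≤n (fresh t i)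
    ; free   = λ where
        zero    zero    → self zero x∈A
        zero    (suc j) → All.map (λ miss → miss j) disjoint
        (suc i) zero    → tabulate⁻ (concat⁻ (++⁻ʳ E (x-avoids j₀))) i
        (suc i) (suc j) → free t i j
    }
    where
    -- The exclusion list is kept variable so that each new tuple can avoid all earlier ones.
    next : ∀ E → FreeTuple (A ∘ suc) (λ i → f (suc i)) E
    next = freeTuple (A ∘ suc) (λ i → f (suc i)) (unc ∘ suc) (λ i → self (suc i))

    used : ℕ → List Cantor
    used zero    = E
    used (suc j) = tabulate (pt (next (used j))) ++ used j

    used-⊇ : ∀ {P : Pred Cantor 0ℓ} {j k} → j ≤ k → All P (used k) → All P (used j)
    used-⊇ {P} j≤k = go (≤⇒≤′ j≤k)
      where
      go : ∀ {j k} → j ≤′ k → All P (used k) → All P (used j)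
      go (≤′-reflexive refl)  all = all
      go {k = suc k} (≤′-step j≤k) all =
        go j≤k (++⁻ʳ (tabulate (pt (next (used k)))) all)

    -- Once `s` has entered `used k`, freshness keeps it out of the tuples from `k` on; if it never
    -- enters, it is in no tuple, as tuple `j` is recorded in `used (suc j)`.
    eventually-miss : ∀ s → Eventually (λ j → ∀ i → ¬ (pt (next (used j)) i ≗ s))
    eventually-miss s with em {∃[ k ] ¬ (s avoids used k)}
    ... | yes (k , hit) = k , λ j k≤j i i≗s →
      hit (used-⊇ {j = k} k≤j (avoids-≗ i≗s (fresh (next (used j)) i)))
    ... | no never = 0 , λ j _ i i≗s → never (suc j , λ av →
      tabulate⁻ (++⁻ˡ (tabulate (pt (next (used j)))) av) i (≗-sym i≗s))

    forbidden : ℕ → List Cantor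
    forbidden j = E ++
      concat (tabulate (λ i → f (suc i) (member (next (used j)) i)))

    x        = proj₁ (unc zero forbidden)
    x∈A      = proj₁ (proj₂ (unc zero forbidden))
    x-avoids = proj₂ (proj₂ (unc zero forbidden))

    -- The tuple is selected only after `x`, which is why `x` had to respect the lists of every
    -- tuple.
    missed = eventually-All (All.universal eventually-miss (f zero x∈A))
    j₀ = proj₁ missed
    t = next (used j₀)

    disjoint : All (λ s → ∀ i → ¬ (pt t i ≗ s)) (f zero x∈A)
    disjoint = proj₂ missed j₀ ≤-refl

  -- Codes common to several neighbourhoods

  eventually-split : ∀ {x s : Cantor} → ¬ (x ≗ s) →
    Eventually (λ m → applyUpTo s m ≢ applyUpTo x m)
  eventually-split {x} {s} x≉s with em {∃[ i ] x i ≢ s i}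
  ... | yes (i , xi≢si) =
    suc i , λ m i<m eq → xi≢si (sym (applyUpTo-≡⇒≡ s x i<m eq))
  ... | no agree = ⊥-elim (x≉s λ i → decidable-stable em (λ xi≢si → agree (i , xi≢si)))

  -- Let `c` list the segments of all `x j` at one common length `m`. A segment of a forbidden `s`
  -- could be listed only if it had length `m` too, and `m` is large enough to tell `s` from each
  -- `x j`.
  common-near : ∀ {n} (x : Fin n → Cantor) (S : Fin n → List Cantor) (k : Fin n → ℕ) →
    (∀ i j → x j avoids S i) → ∃[ c ] (∀ i → Near (x i) (S i) (k i) c)
  common-near x S k av = c , λ i →
    (m , proj₁ late i , subst (applyUpTo (x i) m ∈_) (sym decode-c)
                              (∈-tabulate⁺ {f = λ j → applyUpTo (x j) m} i)) ,
    All.tabulate (λ {s} s∈S m′ s↾m′∈ →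
      unlisted i s∈S m′ (subst (applyUpTo s m′ ∈_) decode-c s↾m′∈))
    where
    ev : Eventually (λ m → (∀ i → k i ≤ m) ×
      (∀ i j → All (λ s → applyUpTo s m ≢ applyUpTo (x j) m) (S i)))
    ev = eventually-×
      (eventually-Fin (λ i → k i , λ m k≤m → k≤m))
      (eventually-Fin (λ i → eventually-Fin (λ j →
        eventually-All (All.map eventually-split (av i j)))))

    m = proj₁ ev
    late = proj₂ ev m ≤-refl
    segments = tabulate (λ j → applyUpTo (x j) m)
    c = encode segments
    decode-c = decode-encode segments

    unlisted : ∀ i {s} → s ∈ S i → ∀ m′ → applyUpTo s m′ ∉ segments
    unlisted i {s} s∈S m′ s↾m′∈ with ∈-tabulate⁻ s↾m′∈
    ... | j , eq with applyUpTo-length s (x j) eq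
    ...   | refl = All.lookup (proj₂ late i j) s∈S eq

  propertyP : ∀ n → PropertyP n
  propertyP n = hausdorff , λ V oV empty →
    decidable-stable em (λ none → meet V oV (λ i c → none (i , c)) empty)
    where
    meet : ∀ V → (∀ i → Open (V i)) → (∀ i → ¬ AtMostCountable (V i)) →
      ¬ Empty (⋂ (Fin n) V)
    -- Freeness of the tuple is exactly what `common-near` asks for; the resulting code is near each
    -- chosen point, hence in each `V i`.
    meet V oV unc empty = empty (code (proj₁ near)) λ i →
      proj₂ (proj₂ (proj₂ (nbhd i (member t i)))) (proj₁ near) (proj₂ near i)
      where
      A : Fin n → Pred Cantor 0ℓ
      A i x = V i x × ¬ IsCode x

      nbhd : ∀ i {x} → A i x →
        ∃[ S ] ∃[ k ] (x avoids S × (∀ m → Near x S k m → V i (code m)))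
      nbhd i (x∈V , x∉D) = inner (oV i) x∈V x∉D

      t = freeTuple A (λ i x∈A → proj₁ (nbhd i x∈A))
        (λ i → uncountable-noncodes (unc i))
        (λ i x∈A → proj₁ (proj₂ (proj₂ (nbhd i x∈A)))) []

      near = common-near (pt t) (λ i → proj₁ (nbhd i (member t i)))
        (λ i → proj₁ (proj₂ (nbhd i (member t i)))) (free t)

proposition2p1 : ExcludedMiddle 0ℓ →
    Σ[ X ∈ TopologicalSpace ]
    ( TopologicalSpace.ZeroDimensional X
    × TopologicalSpace.HasCardinality2^ω X
    × TopologicalSpace.PropertyP<ω X )
proposition2p1 em =
  space , zeroDimensional , bijection (ℕ →-setoid Bool) , λ n _ → propertyP n
  where open Classical em
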